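{- Let $G$ be a 4-regular (quartic) graph of order $p$, where $5\le p\le 8$. Then $\chi_{la}(G)=\chi(G)$, except that $\chi_{la}(K_{4,4})=\chi(K_{4,4})+1$.
   Context: $\chi(G)$ is the chromatic number. For a simple graph $G=(V,E)$ with $q$ edges, a bijection $f:E\to\{1,\dots,q\}$ is a local antimagic labeling if $f^+(u)\neq f^+(v)$ for every edge $uv$, where $f^+(u)=\sum_{e\ni u} f(e)$. The local antimagic chromatic number $\chi_{la}(G)$ is the minimum number of distinct values of $f^+$ over all local antimagic labelings $f$ of $G$. -}

module Defs where

open import Data.Nat using (ℕ; zero; suc; _+_; _≤_; _<ᵇ_)
open import Data.Nat.Properties using (_≟_)
open import Data.Bool using (Bool; true; false; T; if_then_else_)
open import Data.Fin using (Fin; toℕ; _<_)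
open import Data.Fin.Properties using (<-cmp)
open import Data.List using (List; length; map; deduplicate; allFin)
open import Data.Nat.ListAction using (sum)
open import Data.Product using (Σ; Σ-syntax; _×_; _,_)
open import Function.Bundles using (_⤖_; _↔_; Bijection; Inverse)
open import Relation.Binary.PropositionalEquality using (_≡_; _≢_; refl; trans)
open import Relation.Binary.Definitions using (tri<; tri≈; tri>)

record SimpleGraph (n : ℕ) : Set where
  field
    adj : Fin n → Fin n → Bool
    sym : ∀ i j → adj i j ≡ adj j i
    irr : ∀ i → adj i i ≡ false
open SimpleGraph public

Σv : ∀ {n} → (Fin n → ℕ) → ℕ
Σv {n} g = sum (map g (allFin n))

degree : ∀ {n} → SimpleGraph n → Fin n → ℕ
degree G u = Σv (λ v → if adj G u v then 1 else 0)

Regular : ∀ {n} → SimpleGraph n → ℕ → Set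
Regular G r = ∀ u → degree G u ≡ r

-- Edges: unordered pairs {i,j} represented as (i , j) with i < j and adjacent.
Edge : ∀ {n} → SimpleGraph n → Set
Edge {n} G = Σ[ i ∈ Fin n ] Σ[ j ∈ Fin n ] (i < j × T (adj G i j))

edgeCount : ∀ {n} → SimpleGraph n → ℕ
edgeCount G = Σv (λ i → Σv (λ j → if adj G i j then (if toℕ i <ᵇ toℕ j then 1 else 0) else 0))

-- An edge labeling is a bijection E → {1,…,q}; here E ⤖ Fin q, with the
-- label of e being 1 + (index of e).
EdgeLabeling : ∀ {n} → SimpleGraph n → Set
EdgeLabeling G = Edge G ⤖ Fin (edgeCount G)

label : ∀ {n} {G : SimpleGraph n} → EdgeLabeling G → Edge G → ℕ
label f e = suc (toℕ (Bijection.to f e))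

-- label of the edge uv (0 if u,v not adjacent)
edgeLabel : ∀ {n} {G : SimpleGraph n} → EdgeLabeling G → Fin n → Fin n → ℕ
edgeLabel {G = G} f u v with adj G u v in eq | <-cmp u v
... | false | _ = 0
... | true | tri< u<v _ _ = label {G = G} f (u , v , u<v , helper eq)
  where helper : ∀ {b} → b ≡ true → T b
        helper refl = _
... | true | tri≈ _ _ _ = 0
... | true | tri> _ _ v<u = label {G = G} f (v , u , v<u , helper (trans (sym G v u) eq))
  where helper : ∀ {b} → b ≡ true → T b
        helper refl = _

vertexSum : ∀ {n} {G : SimpleGraph n} → EdgeLabeling G → Fin n → ℕ
vertexSum {G = G} f u = Σv (λ v → edgeLabel {G = G} f u v)

IsLocalAntimagic : ∀ {n} {G : SimpleGraph n} → EdgeLabeling G → Set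
IsLocalAntimagic {G = G} f =
  ∀ u v → T (adj G u v) → vertexSum {G = G} f u ≢ vertexSum {G = G} f v

distinctValues : ∀ {n} → (Fin n → ℕ) → ℕ
distinctValues {n} g = length (deduplicate _≟_ (map g (allFin n)))

IsLocalAntimagicChromaticNumber : ∀ {n} → SimpleGraph n → ℕ → Set
IsLocalAntimagicChromaticNumber G k =
  Σ[ f ∈ EdgeLabeling G ] (IsLocalAntimagic {G = G} f × distinctValues (vertexSum {G = G} f) ≡ k)
  × (∀ (f : EdgeLabeling G) → IsLocalAntimagic {G = G} f → k ≤ distinctValues (vertexSum {G = G} f))

ProperColoring : ∀ {n} → SimpleGraph n → (m : ℕ) → (Fin n → Fin m) → Set
ProperColoring G m c = ∀ u v → T (adj G u v) → c u ≢ c v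

IsChromaticNumber : ∀ {n} → SimpleGraph n → ℕ → Set
IsChromaticNumber {n} G k =
  Σ[ c ∈ (Fin n → Fin k) ] ProperColoring G k c
  × (∀ m (c : Fin n → Fin m) → ProperColoring G m c → k ≤ m)

Isomorphic : ∀ {m n} → SimpleGraph m → SimpleGraph n → Set
Isomorphic {m} {n} G H =
  Σ[ σ ∈ (Fin m ↔ Fin n) ] (∀ i j → adj H (Inverse.to σ i) (Inverse.to σ j) ≡ adj G i j)

private
  differ : Bool → Bool → Bool
  differ true b = if b then false else true
  differ false b = b

  differ-sym : ∀ a b → differ a b ≡ differ b a
  differ-sym true true = refl
  differ-sym true false = refl
  differ-sym false true = refl
  differ-sym false false = refl

  differ-irr : ∀ a → differ a a ≡ false
  differ-irr true = refl
  differ-irr false = refl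

  side : Fin 8 → Bool
  side i = toℕ i <ᵇ 4

K44 : SimpleGraph 8
K44 = record
  { adj = λ i j → differ (side i) (side j)
  ; sym = λ i j → differ-sym (side i) (side j)
  ; irr = λ i → differ-irr (side i)
  }

{-# OPTIONS --safe #-}
module Submission where

-- Up to isomorphism there are ten quartic graphs of order 5 to 8.  To see this, renumber the vertices
-- so that 0 is adjacent to exactly 1, 2, 3, 4 and enumerate the at most 553 graphs that remain.  For each of
-- the ten we give an edge labeling by a table.  A local antimagic labeling is a proper coloring by its
-- vertex sums, so χ ≤ χ_la; except for K44, the labeling given has d distinct sums where d - 1 colors do
-- not suffice, so it attains the bound.  For K44, two distinct sums would have to be constant on the two
-- sides; but the sides have the same total, since each edge has one end in each.

open import Algebra.Properties.CommutativeMonoid.Sum as CommutativeMonoidSum using ()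
open import Data.Bool using (Bool; true; false; T; if_then_else_; not; _∧_)
import Data.Bool.Properties as Bool
open import Data.Empty using (⊥)
open import Data.Fin using (Fin; zero; suc; toℕ; #_; fromℕ<; inject≤; _↑ˡ_; _↑ʳ_)
import Data.Fin as Fin
import Data.Fin.Permutation as Perm
import Data.Fin.Properties as Fin
open import Data.List using (List; []; _∷_; _++_; allFin; deduplicate; length; map)
import Data.List as List
open import Data.List.Membership.Propositional using (_∈_)
import Data.List.Membership.Propositional.Properties as Membership
import Data.List.Membership.Setoid.Properties as SetoidMembership
import Data.List.Properties as List
open import Data.List.Relation.Unary.All using (All)
import Data.List.Relation.Unary.All as All
open import Data.List.Relation.Unary.AllPairs using (_∷_)
open import Data.List.Relation.Unary.Any using (Any; here; there; index)
import Data.List.Relation.Unary.Any as Any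
import Data.List.Relation.Unary.Any.Properties as Any
open import Data.List.Relation.Unary.Unique.Propositional using (Unique)
import Data.List.Relation.Unary.Unique.DecPropositional.Properties as Unique
open import Data.Maybe using (Maybe; just; nothing; is-just; _>>=_)
import Data.Maybe as Maybe
open import Data.Nat using (ℕ; zero; suc; _+_; _*_; _≤_; _<_; _<ᵇ_; pred; z≤n; s≤s; _≤?_)
open import Data.Nat.ListAction using (sum)
import Data.Nat.Properties as ℕ
open import Data.Product using (Σ-syntax; ∃-syntax; _×_; _,_; proj₁; proj₂)
import Data.Product as Product
open import Data.Sum using (_⊎_; inj₁; inj₂)
import Data.Sum as Sum
open import Data.Unit using (⊤; tt)
open import Data.Vec using (Vec; []; _∷_; lookup; replicate; tabulate; zipWith)
import Data.Vec as Vec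
import Data.Vec.Properties as Vec
open import Defs hiding (sym)
open import Function using (_∘_)
open import Function.Bundles using (_↔_; Inverse; Equivalence; mk↔ₛ′; mk⤖)
open import Function.Construct.Composition using (_↔-∘_)
open import Function.Construct.Identity using (↔-id)
open import Function.Construct.Symmetry using (↔-sym)
open import Relation.Binary.Definitions using (tri<; tri≈; tri>)
open import Relation.Binary.PropositionalEquality
  using (_≡_; _≢_; _≗_; refl; sym; trans; cong; cong₂; subst; setoid; module ≡-Reasoning)
open import Relation.Nullary using (¬_)
open import Relation.Nullary.Decidable
  using (Dec; yes; no; does; _×-dec_; _⊎-dec_; _→-dec_; ¬?; map′; dec⇒maybe; toWitness)
open import Relation.Nullary.Negation using (contradiction)

open Inverse using (to; from; strictlyInverseˡ; strictlyInverseʳ)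

module ∑ = CommutativeMonoidSum ℕ.+-0-commutativeMonoid

-- Sums over vertices

Σv≡sum : ∀ {n} (g : Fin n → ℕ) → Σv g ≡ ∑.sum g
Σv≡sum g = trans (cong sum (List.map-tabulate (λ i → i) g)) (go g)
  where
  go : ∀ {n} (g : Fin n → ℕ) → sum (List.tabulate g) ≡ ∑.sum g
  go {zero}  g = refl
  go {suc n} g = cong (g zero +_) (go (g ∘ suc))

Σv-cong : ∀ {n} {g h : Fin n → ℕ} → g ≗ h → Σv g ≡ Σv h
Σv-cong g≗h = cong sum (List.map-cong g≗h (allFin _))

Σv-suc : ∀ {n} (g : Fin (suc n) → ℕ) → Σv g ≡ g zero + Σv (g ∘ suc)
Σv-suc g = trans (Σv≡sum g) (cong (g zero +_) (sym (Σv≡sum (g ∘ suc))))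

Σv-+ : ∀ {n} (g h : Fin n → ℕ) → Σv (λ i → g i + h i) ≡ Σv g + Σv h
Σv-+ g h = trans (Σv≡sum (λ i → g i + h i)) (trans (∑.∑-distrib-+ g h) (sym (cong₂ _+_ (Σv≡sum g) (Σv≡sum h))))

Σv-const : ∀ n c → Σv {n} (λ _ → c) ≡ n * c
Σv-const zero    c = refl
Σv-const (suc n) c = trans (Σv-suc {n} (λ _ → c)) (cong (c +_) (Σv-const n c))

Σv-comm : ∀ {m n} (g : Fin m → Fin n → ℕ) → Σv (λ i → Σv (g i)) ≡ Σv (λ j → Σv (λ i → g i j))
Σv-comm g = begin
  Σv (λ i → Σv (g i))                 ≡⟨ Σv-cong (λ i → Σv≡sum (g i)) ⟩
  Σv (λ i → ∑.sum (g i))              ≡⟨ Σv≡sum (λ i → ∑.sum (g i)) ⟩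
  ∑.sum (λ i → ∑.sum (g i))           ≡⟨ ∑.∑-comm g ⟩
  ∑.sum (λ j → ∑.sum (λ i → g i j))   ≡⟨ Σv≡sum (λ j → ∑.sum (λ i → g i j)) ⟨
  Σv (λ j → ∑.sum (λ i → g i j))      ≡⟨ Σv-cong (λ j → Σv≡sum (λ i → g i j)) ⟨
  Σv (λ j → Σv (λ i → g i j))         ∎
  where open ≡-Reasoning

Σv-permute : ∀ {m n} (g : Fin n → ℕ) (σ : Fin m ↔ Fin n) → Σv g ≡ Σv (g ∘ to σ)
Σv-permute g σ = trans (Σv≡sum g) (trans (∑.∑-permute g σ) (sym (Σv≡sum (g ∘ to σ))))

-- Isomorphisms

indicator : Bool → ℕ
indicator b = if b then 1 else 0

Isomorphic-sym : ∀ {m n} (G : SimpleGraph m) (H : SimpleGraph n) → Isomorphic G H → Isomorphic H G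
Isomorphic-sym G H (σ , e) = ↔-sym σ , λ i j →
  trans (sym (e (from σ i) (from σ j))) (cong₂ (adj H) (strictlyInverseˡ σ i) (strictlyInverseˡ σ j))

Isomorphic-trans : ∀ {l m n} (G : SimpleGraph l) (H : SimpleGraph m) (K : SimpleGraph n) →
                   Isomorphic G H → Isomorphic H K → Isomorphic G K
Isomorphic-trans G H K (σ , e) (τ , e′) = τ ↔-∘ σ , λ i j → trans (e′ (to σ i) (to σ j)) (e i j)

≗⇒Isomorphic : ∀ {n} (G H : SimpleGraph n) → (∀ i j → adj H i j ≡ adj G i j) → Isomorphic G H
≗⇒Isomorphic G H e = ↔-id _ , e

pullback : ∀ {m n} → SimpleGraph n → (Fin m → Fin n) → SimpleGraph m
pullback G σ = record
  { adj = λ i j → adj G (σ i) (σ j)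
  ; sym = λ i j → SimpleGraph.sym G (σ i) (σ j)
  ; irr = λ i → irr G (σ i)
  }

Regular-pullback : ∀ {m n r} (G : SimpleGraph n) (σ : Fin m ↔ Fin n) →
                   Regular G r → Regular (pullback G (to σ)) r
Regular-pullback G σ reg u =
  trans (sym (Σv-permute (λ v → indicator (adj G (to σ u) v)) σ)) (reg (to σ u))

ProperColoring-transport : ∀ {m n k} (G : SimpleGraph m) (H : SimpleGraph n) ((σ , _) : Isomorphic G H) →
                           ∀ {c : Fin m → Fin k} → ProperColoring G k c → ProperColoring H k (c ∘ from σ)
ProperColoring-transport G H iso proper u v a =
  proper _ _ (subst T (sym (proj₂ (Isomorphic-sym G H iso) u v)) a)

-- Counting the edges of a quartic graph

handshake : ∀ {n} (G : SimpleGraph n) → edgeCount G + edgeCount G ≡ Σv (degree G)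
handshake G = sym (begin
  Σv (λ i → Σv (λ j → indicator (adj G i j)))   ≡⟨ Σv-cong row ⟩
  Σv (λ i → Σv (e i) + Σv (λ j → e j i))        ≡⟨ Σv-+ (λ i → Σv (e i)) (λ i → Σv (λ j → e j i)) ⟩
  edgeCount G + Σv (λ i → Σv (λ j → e j i))     ≡⟨ cong (edgeCount G +_) (Σv-comm e) ⟨
  edgeCount G + edgeCount G                     ∎)
  where
  open ≡-Reasoning
  -- `e i j` counts the edge ij at its smaller end only. A row of the adjacency matrix thus consists
  -- of upward edges `e i j` and downward edges `e j i`, and each kind totals `edgeCount G` over all
  -- rows.
  e : Fin _ → Fin _ → ℕ
  e i j = if adj G i j then indicator (toℕ i <ᵇ toℕ j) else 0

  trichotomy : ∀ {n} (i j : Fin n) → i ≢ j → 1 ≡ indicator (toℕ i <ᵇ toℕ j) + indicator (toℕ j <ᵇ toℕ i)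
  trichotomy zero    zero    i≢j = contradiction refl i≢j
  trichotomy zero    (suc j) i≢j = refl
  trichotomy (suc i) zero    i≢j = refl
  trichotomy (suc i) (suc j) i≢j = trichotomy i j (i≢j ∘ cong suc)

  split : ∀ i j → indicator (adj G i j) ≡ e i j + e j i
  -- After the rewrite `e i j` and `e j i` both test `adj G i j`, so one case distinction settles
  -- both.
  split i j rewrite SimpleGraph.sym G j i with adj G i j in a
  ... | false = refl
  ... | true  = trichotomy i j λ { refl → contradiction (trans (sym a) (irr G i)) λ () }

  row : ∀ i → degree G i ≡ Σv (e i) + Σv (λ j → e j i)
  row i = trans (Σv-cong (split i)) (Σv-+ (e i) (λ j → e j i))

-- The degree sum is 4n, so the labels that a table has to use are 1 to 2n.
edgeCount-quartic : ∀ {n} (G : SimpleGraph n) → Regular G 4 → edgeCount G ≡ n + n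
edgeCount-quartic {n} G reg = ℕ.*-cancelʳ-≡ (edgeCount G) (n + n) 2 (begin
  edgeCount G * 2            ≡⟨ double (edgeCount G) ⟩
  edgeCount G + edgeCount G  ≡⟨ handshake G ⟩
  Σv (degree G)              ≡⟨ Σv-cong reg ⟩
  Σv {n} (λ _ → 4)           ≡⟨ Σv-const n 4 ⟩
  n * 4                      ≡⟨ ℕ.*-assoc n 2 2 ⟨
  n * 2 * 2                  ≡⟨ cong (_* 2) (double n) ⟩
  (n + n) * 2                ∎)
  where
  open ≡-Reasoning
  double : ∀ m → m * 2 ≡ m + m
  double m = trans (ℕ.*-comm m 2) (cong (m +_) (ℕ.+-identityʳ m))

-- Symmetric matrices given by their strict upper triangle

infixr 5 _▷_

-- First-order data on which enumeration and search can compute; symmetry and a constant diagonal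
-- hold by construction. In `r ▷ t` the vector `r` joins vertex 0 to the later vertices.
data Tri (A : Set) : ℕ → Set where
  △   : Tri A 0
  _▷_ : ∀ {n} → Vec A n → Tri A n → Tri A (suc n)

entry : ∀ {A n} → A → Tri A n → Fin n → Fin n → A
entry z (r ▷ t) zero    zero    = z
entry z (r ▷ t) zero    (suc j) = lookup r j
entry z (r ▷ t) (suc i) zero    = lookup r i
entry z (r ▷ t) (suc i) (suc j) = entry z t i j

entry-sym : ∀ {A n} z (t : Tri A n) i j → entry z t i j ≡ entry z t j i
entry-sym z (r ▷ t) zero    zero    = refl
entry-sym z (r ▷ t) zero    (suc j) = refl
entry-sym z (r ▷ t) (suc i) zero    = refl
entry-sym z (r ▷ t) (suc i) (suc j) = entry-sym z t i j

entry-diagonal : ∀ {A n} z (t : Tri A n) i → entry z t i i ≡ z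
entry-diagonal z (r ▷ t) zero    = refl
entry-diagonal z (r ▷ t) (suc i) = entry-diagonal z t i

mapTri : ∀ {A B n} → (A → B) → Tri A n → Tri B n
mapTri f △       = △
mapTri f (r ▷ t) = Vec.map f r ▷ mapTri f t

entry-mapTri : ∀ {A B n} (f : A → B) z (t : Tri A n) i j → entry (f z) (mapTri f t) i j ≡ f (entry z t i j)
entry-mapTri f z (r ▷ t) zero    zero    = refl
entry-mapTri f z (r ▷ t) zero    (suc j) = Vec.lookup-map j f r
entry-mapTri f z (r ▷ t) (suc i) zero    = Vec.lookup-map i f r
entry-mapTri f z (r ▷ t) (suc i) (suc j) = entry-mapTri f z t i j

upper : ∀ {A n} → (Fin n → Fin n → A) → Tri A n
upper {n = zero}  a = △
upper {n = suc n} a = tabulate (λ j → a zero (suc j)) ▷ upper (λ i j → a (suc i) (suc j))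

entry-upper : ∀ {A n} z (a : Fin n → Fin n → A) → (∀ i j → a i j ≡ a j i) → (∀ i → a i i ≡ z) →
              ∀ i j → entry z (upper a) i j ≡ a i j
entry-upper z a s d zero    zero    = sym (d zero)
entry-upper z a s d zero    (suc j) = Vec.lookup∘tabulate _ j
entry-upper z a s d (suc i) zero    = trans (Vec.lookup∘tabulate _ i) (s zero (suc i))
entry-upper z a s d (suc i) (suc j) = entry-upper z _ (λ i j → s (suc i) (suc j)) (d ∘ suc) i j

graph : ∀ {n} → Tri Bool n → SimpleGraph n
graph t = record { adj = entry false t ; sym = entry-sym false t ; irr = entry-diagonal false t }

graph-upper : ∀ {n} (G : SimpleGraph n) → Isomorphic G (graph (upper (adj G)))
graph-upper G = ≗⇒Isomorphic G (graph (upper (adj G))) (entry-upper false (adj G) (SimpleGraph.sym G) (irr G))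

countTrue : ∀ {n} → Vec Bool n → ℕ
countTrue []          = 0
countTrue (true  ∷ r) = suc (countTrue r)
countTrue (false ∷ r) = countTrue r

addRow subtractRow : ∀ {n} → Vec Bool n → Vec ℕ n → Vec ℕ n
addRow      = zipWith (λ b d → if b then suc d else d)
subtractRow = zipWith (λ b d → if b then pred d else d)

-- Where the bit is set, `addRow` has made the entry positive, so `pred` does not truncate.
subtractRow-addRow : ∀ {n} (r : Vec Bool n) ds → subtractRow r (addRow r ds) ≡ ds
subtractRow-addRow []          []       = refl
subtractRow-addRow (true  ∷ r) (d ∷ ds) = cong (d ∷_) (subtractRow-addRow r ds)
subtractRow-addRow (false ∷ r) (d ∷ ds) = cong (d ∷_) (subtractRow-addRow r ds)

degrees : ∀ {n} → Tri Bool n → Vec ℕ n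
degrees △       = []
degrees (r ▷ t) = countTrue r ∷ addRow r (degrees t)

countTrue≡Σv : ∀ {n} (r : Vec Bool n) → countTrue r ≡ Σv (indicator ∘ lookup r)
countTrue≡Σv []          = refl
countTrue≡Σv (true  ∷ r) = trans (cong suc (countTrue≡Σv r)) (sym (Σv-suc (indicator ∘ lookup (true ∷ r))))
countTrue≡Σv (false ∷ r) = trans (countTrue≡Σv r) (sym (Σv-suc (indicator ∘ lookup (false ∷ r))))

lookup-degrees : ∀ {n} (t : Tri Bool n) i → lookup (degrees t) i ≡ degree (graph t) i
lookup-degrees (r ▷ t) zero    =
  trans (countTrue≡Σv r) (sym (Σv-suc (indicator ∘ entry false (r ▷ t) zero)))
lookup-degrees (r ▷ t) (suc i) = begin
  lookup (addRow r (degrees t)) i                         ≡⟨ Vec.lookup-zipWith _ i r (degrees t) ⟩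
  add (lookup r i) (lookup (degrees t) i)                 ≡⟨ cong (add (lookup r i)) (lookup-degrees t i) ⟩
  add (lookup r i) (degree (graph t) i)                   ≡⟨ add≡+ (lookup r i) ⟩
  indicator (lookup r i) + degree (graph t) i             ≡⟨ Σv-suc (indicator ∘ entry false (r ▷ t) (suc i)) ⟨
  degree (graph (r ▷ t)) (suc i)                          ∎
  where
  open ≡-Reasoning
  add : Bool → ℕ → ℕ
  add b d = if b then suc d else d
  add≡+ : ∀ b {d} → add b d ≡ indicator b + d
  add≡+ true  = refl
  add≡+ false = refl

degrees-regular : ∀ {n r} (t : Tri Bool n) → Regular (graph t) r → degrees t ≡ replicate n r
degrees-regular {n} {r} t reg = begin
  degrees t                          ≡⟨ Vec.tabulate∘lookup (degrees t) ⟨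
  tabulate (lookup (degrees t))      ≡⟨ Vec.tabulate-cong pointwise ⟩
  tabulate (lookup (replicate n r))  ≡⟨ Vec.tabulate∘lookup (replicate n r) ⟩
  replicate n r                      ∎
  where
  open ≡-Reasoning
  pointwise : ∀ i → lookup (degrees t) i ≡ lookup (replicate n r) i
  pointwise i = trans (trans (lookup-degrees t i) (reg i)) (sym (Vec.lookup-replicate i r))

-- Exhaustive enumeration of graphs with prescribed degrees

-- An edge uses up one unit of remaining degree at both of its ends. If an end has none left, no
-- graph continues this branch and the check holds vacuously.
ifBothPositive : ℕ → ℕ → (ℕ → ℕ → Bool) → Bool
ifBothPositive (suc d) (suc e) k = k d e
ifBothPositive _       _       k = true

-- The conjunction of `k r es` over all rows `r` with `d` true bits and all `es` with
-- `addRow r es ≡ ds`. The continuation receives the degrees still to be realized by the later rows.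
forallRow : ∀ {n} → Vec ℕ n → ℕ → (Vec Bool n → Vec ℕ n → Bool) → Bool
forallRow []       zero    k = k [] []
forallRow []       (suc d) k = true
forallRow (e ∷ es) d       k =
  forallRow es d (λ r es′ → k (false ∷ r) (e ∷ es′)) ∧
  ifBothPositive d e (λ d′ e′ → forallRow es d′ (λ r es′ → k (true ∷ r) (e′ ∷ es′)))

forallTri : ∀ {n} → Vec ℕ n → (Tri Bool n → Bool) → Bool
forallTri []       k = k △
forallTri (d ∷ ds) k = forallRow ds d (λ r ds′ → forallTri ds′ (λ t → k (r ▷ t)))

-- The bits of `r` pick the conjunct to follow. At a true bit, `countTrue r` and the entry of
-- `addRow r ds` are successors, so `ifBothPositive` takes its main branch.
forallRow-sound : ∀ {n} (r : Vec Bool n) ds k → T (forallRow (addRow r ds) (countTrue r) k) → T (k r ds)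
forallRow-sound []          []       k p = p
forallRow-sound (true  ∷ r) (d ∷ ds) k p = forallRow-sound r ds _ (proj₂ (Equivalence.to Bool.T-∧ p))
forallRow-sound (false ∷ r) (d ∷ ds) k p = forallRow-sound r ds _ (proj₁ (Equivalence.to Bool.T-∧ p))

forallTri-sound : ∀ {n} (t : Tri Bool n) k → T (forallTri (degrees t) k) → T (k t)
forallTri-sound △       k p = p
forallTri-sound (r ▷ t) k p = forallTri-sound t _ (forallRow-sound r (degrees t) _ p)

-- Isomorphism search

selections : ∀ {A : Set} → List A → List (A × List A)
selections []       = []
selections (x ∷ xs) = (x , xs) ∷ map (λ (y , ys) → y , x ∷ ys) (selections xs)

compatible : ∀ {m n} → Tri Bool n → Fin n → Vec Bool m → Vec (Fin n) m → Bool
compatible t x []      []       = true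
compatible t x (b ∷ r) (y ∷ ys) = (if entry false t x y then b else not b) ∧ compatible t x r ys

firstJust : ∀ {A B : Set} → (A → Maybe B) → List A → Maybe B
firstJust f []       = nothing
firstJust f (x ∷ xs) with f x
... | just y  = just y
... | nothing = firstJust f xs

-- Backtracking in continuation-passing style: later vertices are placed first, and a `nothing` from
-- `k` makes `firstJust` try the next image.
extendEmbedding : ∀ {m n} {R : Set} → Tri Bool m → Tri Bool n → List (Fin n) →
                  (Vec (Fin n) m → List (Fin n) → Maybe R) → Maybe R
extendEmbedding △       t free k = k [] free
extendEmbedding (r ▷ s) t free k = extendEmbedding s t free λ ys free′ →
  firstJust (λ (x , free″) → if compatible t x r ys then k (x ∷ ys) free″ else nothing)
            (selections free′)

findEmbedding : ∀ {n} → Tri Bool n → Tri Bool n → Maybe (Vec (Fin n) n)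
findEmbedding s t = extendEmbedding s t (allFin _) (λ ys _ → just ys)

-- The last index if the element does not occur.
position : ∀ {m n} → Vec (Fin n) (suc m) → Fin n → Fin (suc m)
position {zero}  _        y = zero
position {suc m} (x ∷ xs) y = if does (x Fin.≟ y) then zero else suc (position xs y)

isomorphism? : ∀ {n} (G H : SimpleGraph n) (f g : Fin n → Fin n) → Maybe (Isomorphic G H)
isomorphism? G H f g = Maybe.map (λ (l , r , e) → mk↔ₛ′ f g l r , e) (dec⇒maybe
  (Fin.all? (λ i → f (g i) Fin.≟ i) ×-dec
   Fin.all? (λ i → g (f i) Fin.≟ i) ×-dec
   Fin.all? (λ i → Fin.all? λ j → adj H (f i) (f j) Bool.≟ adj G i j)))

-- The embedding search needs no correctness proof, as its result is validated here.
findIsomorphism : ∀ {n} (s t : Tri Bool (suc n)) → Maybe (Isomorphic (graph s) (graph t))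
findIsomorphism s t = findEmbedding s t >>= λ ys →
  isomorphism? (graph s) (graph t) (lookup ys) (position ys)

findAmong : ∀ {n} (s : Tri Bool (suc n)) (ts : List (Tri Bool (suc n))) →
            Maybe (Any (λ t → Isomorphic (graph s) (graph t)) ts)
findAmong s []       = nothing
findAmong s (t ∷ ts) with findIsomorphism s t
... | just p  = just (here p)
... | nothing = Maybe.map there (findAmong s ts)

fromIsJust : ∀ {A : Set} (m : Maybe A) → T (is-just m) → A
fromIsJust (just x) _ = x

-- Classification of quartic graphs

-- By induction: some true position is swapped to the front and the rest is sorted with one true
-- value fewer. If there is none, `k` is 0 and the identity serves.
sortTrueFirst : ∀ {n} (b : Fin n → Bool) k → Σv (indicator ∘ b) ≡ k →
                Σ[ σ ∈ Fin n ↔ Fin n ] (∀ i → b (to σ i) ≡ (toℕ i <ᵇ k))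
sortTrueFirst {zero}  b k eq = Perm.id , λ ()
sortTrueFirst {suc n} b k eq with Fin.any? (Bool.T? ∘ b)
... | no none = Perm.id , λ i → trans (allFalse i) (cong (toℕ i <ᵇ_) 0≡k)
  where
  allFalse : ∀ i → b i ≡ false
  allFalse i with b i in eq
  ... | true  = contradiction (i , subst T (sym eq) tt) none
  ... | false = refl
  0≡k : 0 ≡ k
  0≡k = trans (sym (trans (Σv-cong (cong indicator ∘ allFalse)) (trans (Σv-const (suc n) 0) (ℕ.*-zeroʳ n)))) eq
... | yes (j , bj) = go k (begin
    suc (Σv (indicator ∘ b′ ∘ suc))               ≡⟨ cong (λ x → indicator x + Σv (indicator ∘ b′ ∘ suc)) bj≡true ⟨
    indicator (b j) + Σv (indicator ∘ b′ ∘ suc)   ≡⟨ Σv-suc (indicator ∘ b′) ⟨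
    Σv (indicator ∘ b′)                           ≡⟨ Σv-permute (indicator ∘ b) π ⟨
    Σv (indicator ∘ b)                            ≡⟨ eq ⟩
    k                                             ∎)
  where
  open ≡-Reasoning
  π : Fin (suc n) ↔ Fin (suc n)
  π = Perm.transpose zero j
  b′ : Fin (suc n) → Bool
  b′ = b ∘ to π
  bj≡true : b j ≡ true
  bj≡true = Equivalence.to Bool.T-≡ bj

  go : ∀ k → suc (Σv (indicator ∘ b′ ∘ suc)) ≡ k →
       Σ[ σ ∈ Fin (suc n) ↔ Fin (suc n) ] (∀ i → b (to σ i) ≡ (toℕ i <ᵇ k))
  go (suc k) eq with sortTrueFirst (b′ ∘ suc) k (ℕ.suc-injective eq)
  ... | σ , sorted = Perm.lift₀ σ Perm.∘ₚ π , λ where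
    zero    → bj≡true
    (suc i) → sorted i

firstRow : ∀ n → Vec Bool n
firstRow n = tabulate (λ j → toℕ j <ᵇ 4)

-- Fixing the first row costs nothing up to isomorphism and keeps the enumeration small. The
-- vertices joined to 0 have degree 3 left, the others 4.
forallQuartic : ∀ n → (Tri Bool (suc n) → Bool) → Bool
forallQuartic n k = forallTri (subtractRow (firstRow n) (replicate n 4)) (λ t → k (firstRow n ▷ t))

forallQuartic-sound : ∀ {n} r (t : Tri Bool n) k → r ≡ firstRow n → Regular (graph (r ▷ t)) 4 →
                      T (forallQuartic n k) → T (k (r ▷ t))
forallQuartic-sound {n} r t k refl reg p =
  forallTri-sound t _ (subst (λ ds → T (forallTri ds (λ t → k (r ▷ t)))) remaining p)
  where
  remaining : subtractRow r (replicate n 4) ≡ degrees t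
  -- By regularity `addRow r (degrees t)` is constantly 4; subtracting the row leaves `degrees t`.
  remaining = trans (cong (subtractRow r) (sym (Vec.∷-injectiveʳ (degrees-regular (r ▷ t) reg))))
                    (subtractRow-addRow r (degrees t))

-- Renumbering the neighbours of 0 turns `G` into an enumerated `graph s`, and for that `s` the
-- Boolean check guarantees that the search has returned an isomorphism.
classify : ∀ {n} (ts : List (Tri Bool (suc n))) → forallQuartic n (λ s → is-just (findAmong s ts)) ≡ true →
           (G : SimpleGraph (suc n)) → Regular G 4 → Any (λ t → Isomorphic G (graph t)) ts
classify {n} ts p G reg =
  Any.map (λ {t} → Isomorphic-trans G (graph s) (graph t) G≅s)
    (fromIsJust (findAmong s ts)
      (forallQuartic-sound _ _ (λ s → is-just (findAmong s ts)) (Vec.tabulate-cong sorted) s-reg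
        (Equivalence.from Bool.T-≡ p)))
  where
  tail : ℕ
  tail = Σv (indicator ∘ adj G zero ∘ suc)
  row : Σ[ σ ∈ Fin n ↔ Fin n ] (∀ i → adj G zero (suc (to σ i)) ≡ (toℕ i <ᵇ 4))
  row = sortTrueFirst (adj G zero ∘ suc) 4 (begin
    tail                                ≡⟨ cong (λ b → indicator b + tail) (irr G zero) ⟨
    indicator (adj G zero zero) + tail  ≡⟨ Σv-suc (indicator ∘ adj G zero) ⟨
    degree G zero                       ≡⟨ reg zero ⟩
    4                                   ∎)
    where open ≡-Reasoning
  sorted = proj₂ row
  π : Fin (suc n) ↔ Fin (suc n)
  π = Perm.lift₀ (proj₁ row)
  G′ = pullback G (to π)
  s = upper (adj G′)
  G≅s : Isomorphic G (graph s)
  G≅s = Isomorphic-trans G G′ (graph s) (Isomorphic-sym G′ G (π , λ _ _ → refl)) (graph-upper G′)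
  s-reg : Regular (graph s) 4
  s-reg u = trans (Σv-cong (λ v → cong indicator (proj₂ (graph-upper G′) u v))) (Regular-pullback G π reg u)

-- Labelings from edge weights

-- edgeLabel f u v is stuck on its with-function applied to adj G u v and refl, and abstracting over
-- adj G u v alone makes that refl ill-typed.  Unification recovers here the stuck term as a function
-- of the equality proof; edgeLabelVia-cases then abstracts over adj G u v and the proof simultaneously.
mutual
  edgeLabelVia : ∀ {n} (G : SimpleGraph n) (f : EdgeLabeling G) u v → adj G u v ≡ adj G u v → ℕ
  edgeLabelVia = _

  edgeLabel≡edgeLabelVia : ∀ {n} (G : SimpleGraph n) (f : EdgeLabeling G) u v →
                           edgeLabel {G = G} f u v ≡ edgeLabelVia G f u v refl
  edgeLabel≡edgeLabelVia G f u v with refl {x = adj G u v}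
  ... | _ = refl

-- The left side of the equation is hidden in the parameters, so abstracting over `adj G u v`
-- replaces only the index `b` and the proof remains one of `adj G u v ≡ b`.
record Adjacency {n} (G : SimpleGraph n) (u v : Fin n) (b : Bool) : Set where
  constructor adjacency
  field proof : adj G u v ≡ b

-- A view of the values of `edgeLabel`, through which later case distinctions avoid its stuck
-- `with`.
data EdgeLabelCase {n} (G : SimpleGraph n) (f : EdgeLabeling G) (u v : Fin n) : ℕ → Set where
  none  : adj G u v ≡ false → EdgeLabelCase G f u v 0
  below : ∀ u<v a → EdgeLabelCase G f u v (label {G = G} f (u , v , u<v , a))
  above : ∀ v<u a → EdgeLabelCase G f u v (label {G = G} f (v , u , v<u , a))

edgeLabelVia-cases : ∀ {n} (G : SimpleGraph n) (f : EdgeLabeling G) u v (s : Adjacency G u v (adj G u v)) →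
                     EdgeLabelCase G f u v (edgeLabelVia G f u v (Adjacency.proof s))
edgeLabelVia-cases G f u v s with adj G u v | s | Fin.<-cmp u v
... | false | adjacency eq | _             = none eq
... | true  | _            | tri< u<v _ _  = below u<v _
... | true  | adjacency eq | tri≈ _ refl _ = contradiction (trans (sym eq) (irr G u)) λ ()
... | true  | _            | tri> _ _ v<u  = above v<u _

edgeLabel-cases : ∀ {n} (G : SimpleGraph n) (f : EdgeLabeling G) u v →
                  EdgeLabelCase G f u v (edgeLabel {G = G} f u v)
edgeLabel-cases G f u v = subst (EdgeLabelCase G f u v) (sym (edgeLabel≡edgeLabelVia G f u v))
  (edgeLabelVia-cases G f u v (adjacency refl))

label-cong : ∀ {n} (G : SimpleGraph n) (f : EdgeLabeling G) {u v} u<v a u<v′ a′ →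
             label {G = G} f (u , v , u<v , a) ≡ label {G = G} f (u , v , u<v′ , a′)
label-cong G f {u} {v} u<v a u<v′ a′ =
  cong₂ (λ p q → label {G = G} f (u , v , p , q)) (Fin.<-irrelevant u<v u<v′) (Bool.T-irrelevant a a′)

nonadjacent-sym : ∀ {n} (G : SimpleGraph n) {u v} → adj G u v ≡ false → ¬ T (adj G v u)
nonadjacent-sym G {u} {v} na = subst T (trans (SimpleGraph.sym G v u) na)

edgeLabel-nonadjacent : ∀ {n} (G : SimpleGraph n) (f : EdgeLabeling G) {u v} → adj G u v ≡ false →
                        edgeLabel {G = G} f u v ≡ 0
edgeLabel-nonadjacent G f {u} {v} na with edgeLabel {G = G} f u v | edgeLabel-cases G f u v
... | _ | none _    = refl
... | _ | below _ a = contradiction (subst T na a) λ ()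
... | _ | above _ a = contradiction a (nonadjacent-sym G na)

edgeLabel-sym : ∀ {n} (G : SimpleGraph n) (f : EdgeLabeling G) u v →
                edgeLabel {G = G} f u v ≡ edgeLabel {G = G} f v u
edgeLabel-sym G f u v
  with edgeLabel {G = G} f u v | edgeLabel-cases G f u v | edgeLabel {G = G} f v u | edgeLabel-cases G f v u
... | _ | none _      | _ | none _        = refl
... | _ | none na     | _ | below _ a     = contradiction a (nonadjacent-sym G na)
... | _ | none na     | _ | above _ a     = contradiction (subst T na a) λ ()
... | _ | below _ a   | _ | none na       = contradiction a (nonadjacent-sym G na)
... | _ | above _ a   | _ | none na       = contradiction (subst T na a) λ ()
... | _ | below u<v a | _ | above u<v′ a′ = label-cong G f u<v a u<v′ a′
... | _ | above v<u a | _ | below v<u′ a′ = label-cong G f v<u a v<u′ a′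
... | _ | below u<v _ | _ | below v<u _   = contradiction v<u (Fin.<-asym u<v)
... | _ | above v<u _ | _ | above u<v _   = contradiction v<u (Fin.<-asym u<v)

-- A labeling as a symmetric matrix vanishing off the edges. Unlike a bijection out of `Edge G`,
-- this form can be checked entry by entry and transported along isomorphisms directly.
record IsWeighting {n} (G : SimpleGraph n) (q : ℕ) (w : Fin n → Fin n → ℕ) : Set where
  field
    adjacent   : ∀ i j → adj G i j ≡ (0 <ᵇ w i j)
    symmetric  : ∀ i j → w i j ≡ w j i
    bounded    : ∀ i j → w i j ≤ q
    injective  : ∀ i j k l → T (0 <ᵇ w i j) → w i j ≡ w k l → (i ≡ k × j ≡ l) ⊎ (i ≡ l × j ≡ k)
    surjective : ∀ (l : Fin q) → ∃[ i ] ∃[ j ] w i j ≡ suc (toℕ l)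

IsWeighting-transport : ∀ {m n q w} (G : SimpleGraph m) (H : SimpleGraph n) ((σ , _) : Isomorphic G H) →
                        IsWeighting H q w → IsWeighting G q (λ i j → w (to σ i) (to σ j))
IsWeighting-transport {w = w} G H (σ , e) W = record
  { adjacent   = λ i j → trans (sym (e i j)) (adjacent _ _)
  ; symmetric  = λ i j → symmetric _ _
  ; bounded    = λ i j → bounded _ _
  ; injective  = λ i j k l p eq → Sum.map (Product.map reflect reflect) (Product.map reflect reflect)
                                          (injective _ _ _ _ p eq)
  ; surjective = λ l → let i , j , eq = surjective l in
      from σ i , from σ j , trans (cong₂ w (strictlyInverseˡ σ i) (strictlyInverseˡ σ j)) eq
  }
  where
  open IsWeighting W
  reflect : ∀ {i j} → to σ i ≡ to σ j → i ≡ j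
  reflect {i} {j} eq = trans (sym (strictlyInverseʳ σ i)) (trans (cong (from σ) eq) (strictlyInverseʳ σ j))

-- Labels start at 1 and `Fin q` at 0, so a positive weight x has index x - 1.
predFin : ∀ x {q} → T (0 <ᵇ x) → x ≤ q → Fin q
predFin (suc x) _ x<q = fromℕ< x<q

suc-predFin : ∀ x {q} (p : T (0 <ᵇ x)) (x≤q : x ≤ q) → suc (toℕ (predFin x p x≤q)) ≡ x
suc-predFin (suc x) _ x<q = cong suc (Fin.toℕ-fromℕ< x<q)

module Weighted {n} (G : SimpleGraph n) {w} (W : IsWeighting G (edgeCount G) w) where
  open IsWeighting W

  positive : ∀ {i j} → T (adj G i j) → T (0 <ᵇ w i j)
  positive {i} {j} = subst T (adjacent i j)

  weight⇒adj : ∀ {i j l} → w i j ≡ suc l → T (adj G i j)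
  weight⇒adj {i} {j} eq = subst T (sym (trans (adjacent i j) (cong (0 <ᵇ_) eq))) tt

  position-of : Edge G → Fin (edgeCount G)
  position-of (i , j , _ , a) = predFin (w i j) (positive a) (bounded i j)

  suc-position-of : ∀ {i j} i<j (a : T (adj G i j)) → suc (toℕ (position-of (i , j , i<j , a))) ≡ w i j
  suc-position-of {i} {j} _ a = suc-predFin (w i j) (positive a) (bounded i j)

  position-of-injective : ∀ {e e′} → position-of e ≡ position-of e′ → e ≡ e′
  position-of-injective {i , j , i<j , a} {k , l , k<l , b} eq
    with injective i j k l (positive a)
           (trans (sym (suc-position-of i<j a)) (trans (cong (suc ∘ toℕ) eq) (suc-position-of k<l b)))
  ... | inj₁ (refl , refl) = cong₂ (λ p q → i , j , p , q) (Fin.<-irrelevant i<j k<l) (Bool.T-irrelevant a b)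
  -- Both edges list their smaller end first, so one cannot be the other reversed.
  ... | inj₂ (refl , refl) = contradiction k<l (Fin.<-asym i<j)

  position-of-surjective : ∀ l → ∃[ e ] position-of e ≡ l
  position-of-surjective l with surjective l
  ... | i , j , eq with Fin.<-cmp i j
  ...   | tri< i<j _ _  = (i , j , i<j , weight⇒adj eq) ,
                          Fin.toℕ-injective (ℕ.suc-injective (trans (suc-position-of i<j (weight⇒adj eq)) eq))
  ...   | tri≈ _ refl _ = contradiction (subst T (irr G i) (weight⇒adj eq)) λ ()
  ...   | tri> _ _ j<i  = (j , i , j<i , weight⇒adj eq′) ,
                          Fin.toℕ-injective (ℕ.suc-injective (trans (suc-position-of j<i (weight⇒adj eq′)) eq′))
    where eq′ = trans (symmetric j i) eq

  labeling : EdgeLabeling G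
  labeling = mk⤖ {to = position-of} (position-of-injective , λ l →
    let e , eq = position-of-surjective l in e , λ { refl → eq })

  edgeLabel-labeling : ∀ u v → edgeLabel {G = G} labeling u v ≡ w u v
  edgeLabel-labeling u v with edgeLabel {G = G} labeling u v | edgeLabel-cases G labeling u v
  ... | _ | below u<v a = suc-position-of u<v a
  ... | _ | above v<u a = trans (suc-position-of v<u a) (symmetric v u)
  ... | _ | none na     = sym (zero-weight (trans (sym (adjacent u v)) na))
    where
    zero-weight : ∀ {x} → (0 <ᵇ x) ≡ false → x ≡ 0
    zero-weight {zero} _ = refl

-- Numbers of distinct values

Unique-lookup-injective : ∀ {A : Set} {xs : List A} → Unique xs →
                          ∀ {i j} → List.lookup xs i ≡ List.lookup xs j → i ≡ j
Unique-lookup-injective (_ ∷ _)   {zero}  {zero}  eq = refl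
Unique-lookup-injective (x≢ ∷ _)  {zero}  {suc j} eq = contradiction eq (All.lookup x≢ (Membership.∈-lookup j))
Unique-lookup-injective (x≢ ∷ _)  {suc i} {zero}  eq = contradiction (sym eq) (All.lookup x≢ (Membership.∈-lookup i))
Unique-lookup-injective (_ ∷ xs!) {suc i} {suc j} eq = cong suc (Unique-lookup-injective xs! eq)

-- Pigeonhole: sending each position in `xs` to a position of the same element in `ys` is injective
-- because `xs` has no repetitions.
Unique-⊆⇒length≤ : ∀ {A : Set} {xs ys : List A} → Unique xs →
                   (∀ {x} → x ∈ xs → x ∈ ys) → length xs ≤ length ys
Unique-⊆⇒length≤ {xs = xs} xs! xs⊆ys = Fin.injective⇒≤ {f = λ i → index (xs⊆ys (Membership.∈-lookup i))}
  λ {i} {j} eq → Unique-lookup-injective xs!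
    (SetoidMembership.index-injective (setoid _) (xs⊆ys (Membership.∈-lookup i)) (xs⊆ys (Membership.∈-lookup j)) eq)

values : ∀ {n} → (Fin n → ℕ) → List ℕ
values {n} g = deduplicate ℕ._≟_ (map g (allFin n))

∈-values : ∀ {n} (g : Fin n → ℕ) i → g i ∈ values g
∈-values g i = Membership.∈-deduplicate⁺ ℕ._≟_ (Membership.∈-map⁺ g (Membership.∈-allFin i))

distinctValues-≤ : ∀ {m n} (g : Fin m → ℕ) (h : Fin n → ℕ) (σ : Fin m → Fin n) → g ≗ h ∘ σ →
                   distinctValues g ≤ distinctValues h
distinctValues-≤ g h σ g≗hσ = Unique-⊆⇒length≤ (Unique.deduplicate-! ℕ._≟_ (map g (allFin _))) λ x∈ →
  let i , _ , eq = Membership.∈-map⁻ g (Membership.∈-deduplicate⁻ ℕ._≟_ (map g (allFin _)) x∈)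
  in subst (_∈ values h) (sym (trans eq (g≗hσ i))) (∈-values h (σ i))

valueColoring : ∀ {n} (g : Fin n → ℕ) → Fin n → Fin (distinctValues g)
valueColoring g i = index (∈-values g i)

valueColoring-reflects : ∀ {n} (g : Fin n → ℕ) {i j} → valueColoring g i ≡ valueColoring g j → g i ≡ g j
valueColoring-reflects g {i} {j} = SetoidMembership.index-injective (setoid _) (∈-values g i) (∈-values g j)

localAntimagic⇒proper : ∀ {n} (G : SimpleGraph n) (f : EdgeLabeling G) → IsLocalAntimagic {G = G} f →
                        ProperColoring G _ (valueColoring (vertexSum {G = G} f))
localAntimagic⇒proper G f la u v a = la u v a ∘ valueColoring-reflects (vertexSum {G = G} f)

chromatic-≤ : ∀ {n k} (G : SimpleGraph n) → IsChromaticNumber G k → (f : EdgeLabeling G) →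
              IsLocalAntimagic {G = G} f → k ≤ distinctValues (vertexSum {G = G} f)
chromatic-≤ G (_ , _ , minimal) f la = minimal _ _ (localAntimagic⇒proper G f la)

-- Exhaustive search for proper colorings

Proper : ∀ {m n} → Tri Bool n → Vec (Fin m) n → Set
Proper △       []       = ⊤
Proper (r ▷ t) (x ∷ xs) = Proper t xs × (∀ j → T (lookup r j) → x ≢ lookup xs j)

-- Colors the last vertex first. The edge conditions of each new vertex precede the rest of the
-- search, so an improper partial coloring is cut off at once.
forallProper? : ∀ {m n} (t : Tri Bool n) {Q : Vec (Fin m) n → Set} → (∀ xs → Dec (Q xs)) →
                Dec (∀ xs → Proper t xs → Q xs)
forallProper? △       Q? = map′ (λ { q [] _ → q }) (λ h → h [] tt) (Q? [])
forallProper? (r ▷ t) Q? =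
  map′ (λ { h (x ∷ xs) (p , x≢) → h xs p x x≢ }) (λ h xs p x x≢ → h (x ∷ xs) (p , x≢))
    (forallProper? t λ xs → Fin.all? λ x →
      Fin.all? (λ j → Bool.T? (lookup r j) →-dec ¬? (x Fin.≟ lookup xs j)) →-dec Q? (x ∷ xs))

Uncolorable : ∀ {n} → Tri Bool n → ℕ → Set
Uncolorable {n} t m = (xs : Vec (Fin m) n) → Proper t xs → ⊥

ProperColoring⇒Proper : ∀ {m n} (t : Tri Bool n) (c : Fin n → Fin m) →
                        ProperColoring (graph t) m c → Proper t (tabulate c)
ProperColoring⇒Proper △       c p = tt
ProperColoring⇒Proper (r ▷ t) c p =
  ProperColoring⇒Proper t (c ∘ suc) (λ u v → p (suc u) (suc v)) ,
  λ j a eq → p zero (suc j) a (trans eq (Vec.lookup∘tabulate (c ∘ suc) j))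

-- If k were at most d, the k colors could be included among d colors, giving a forbidden coloring.
Uncolorable⇒< : ∀ {n d k} (t : Tri Bool n) → Uncolorable t d → (c : Fin n → Fin k) →
                ProperColoring (graph t) k c → d < k
Uncolorable⇒< {d = d} {k} t un c p with suc d ≤? k
... | yes d<k = d<k
... | no  d≮k = contradiction
  (ProperColoring⇒Proper t (λ u → inject≤ (c u) k≤d) (λ u v a eq → p u v a (Fin.inject≤-injective k≤d k≤d _ _ eq)))
  (un _)
  where
  k≤d : k ≤ d
  k≤d = ℕ.≤-pred (ℕ.≰⇒> d≮k)

-- Weight tables

support : ∀ {n} → Tri ℕ n → Tri Bool n
support = mapTri (0 <ᵇ_)

tableSum : ∀ {n} → Tri ℕ n → Fin n → ℕ
tableSum t u = Σv (entry 0 t u)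

-- The decidable conditions on a labeling with 2n labels. The remaining fields of `IsWeighting`,
-- symmetry and adjacency as support, hold for every table.
record IsLocalAntimagicTable {n} (t : Tri ℕ n) : Set where
  constructor mk
  field
    bounded    : ∀ i j → entry 0 t i j ≤ n + n
    injective  : ∀ i j k l → T (0 <ᵇ entry 0 t i j) → entry 0 t i j ≡ entry 0 t k l →
                 (i ≡ k × j ≡ l) ⊎ (i ≡ l × j ≡ k)
    surjective : ∀ (l : Fin (n + n)) → ∃[ i ] ∃[ j ] entry 0 t i j ≡ suc (toℕ l)
    antimagic  : ∀ u v → T (entry false (support t) u v) → tableSum t u ≢ tableSum t v

isLocalAntimagicTable? : ∀ {n} (t : Tri ℕ n) → Dec (IsLocalAntimagicTable t)
isLocalAntimagicTable? t =
  map′ (λ (b , i , s , a) → mk b i s a) (λ (mk b i s a) → b , i , s , a)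
    ((Fin.all? λ i → Fin.all? λ j → entry 0 t i j ≤? _) ×-dec
     (Fin.all? λ i → Fin.all? λ j → Fin.all? λ k → Fin.all? λ l →
       Bool.T? _ →-dec (entry 0 t i j ℕ.≟ entry 0 t k l →-dec
         ((i Fin.≟ k ×-dec j Fin.≟ l) ⊎-dec (i Fin.≟ l ×-dec j Fin.≟ k)))) ×-dec
     (Fin.all? λ l → Fin.any? λ i → Fin.any? λ j → entry 0 t i j ℕ.≟ suc (toℕ l)) ×-dec
     (Fin.all? λ u → Fin.all? λ v → Bool.T? _ →-dec ¬? (tableSum t u ℕ.≟ tableSum t v)))

-- If the sums take d values, d - 1 colors must not suffice, so d is a lower bound for the chromatic
-- number.
IsOptimalTable : ∀ {n} → Tri ℕ n → Set
IsOptimalTable t = IsLocalAntimagicTable t × Uncolorable (support t) (pred (distinctValues (tableSum t)))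

isOptimalTable? : ∀ {n} (t : Tri ℕ n) → Dec (IsOptimalTable t)
-- `Uncolorable` is the statement that every proper coloring satisfies the empty predicate.
isOptimalTable? t = isLocalAntimagicTable? t ×-dec forallProper? (support t) (λ _ → no λ ())

-- The table is pulled back along the isomorphism. Each vertex sum is the table's sum at the image
-- vertex, so adjacent sums differ and no new value arises.
table⇒labeling : ∀ {n} (G : SimpleGraph n) → Regular G 4 → (t : Tri ℕ n) → IsLocalAntimagicTable t →
                 Isomorphic G (graph (support t)) →
                 Σ[ f ∈ EdgeLabeling G ] (IsLocalAntimagic {G = G} f ×
                   distinctValues (vertexSum {G = G} f) ≤ distinctValues (tableSum t))
table⇒labeling {n} G reg t table iso@(σ , e) =
  labeling ,
  (λ u v a eq → antimagic (to σ u) (to σ v) (subst T (sym (e u v)) a)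
                  (trans (sym (sums u)) (trans eq (sums v)))) ,
  distinctValues-≤ (vertexSum {G = G} labeling) (tableSum t) (to σ) sums
  where
  open IsLocalAntimagicTable table
  W : IsWeighting (graph (support t)) (n + n) (entry 0 t)
  W = record
    { adjacent = entry-mapTri (0 <ᵇ_) 0 t ; symmetric = entry-sym 0 t
    ; bounded = bounded ; injective = injective ; surjective = surjective }
  open Weighted G (subst (λ q → IsWeighting G q (λ i j → entry 0 t (to σ i) (to σ j))) (sym (edgeCount-quartic G reg))
                         (IsWeighting-transport G (graph (support t)) iso W))
  sums : ∀ u → vertexSum {G = G} labeling u ≡ tableSum t (to σ u)
  sums u = trans (Σv-cong (edgeLabel-labeling u)) (sym (Σv-permute (entry 0 t (to σ u)) σ))

-- With d the number of sums of the table, the pulled-back labeling has at most d values,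
-- uncolorability gives d ≤ k, and every local antimagic labeling has at least k.
optimal⇒χ-la : ∀ {n k} (G : SimpleGraph n) → Regular G 4 → IsChromaticNumber G k →
               (t : Tri ℕ n) → IsOptimalTable t → Isomorphic G (graph (support t)) →
               IsLocalAntimagicChromaticNumber G k
optimal⇒χ-la {k = k} G reg χ@(c , proper , _) t (table , un) iso =
  let f , la , ≤d = table⇒labeling G reg t table iso in
  f , (la , ℕ.≤-antisym (ℕ.≤-trans ≤d d≤k) (chromatic-≤ G χ f la)) , chromatic-≤ G χ
  where
  suc-pred-≤ : ∀ {d} → pred d < k → d ≤ k
  suc-pred-≤ {zero}  _ = z≤n
  suc-pred-≤ {suc d} p = p
  d≤k : distinctValues (tableSum t) ≤ k
  d≤k = suc-pred-≤ (Uncolorable⇒< (support t) un _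
    (ProperColoring-transport G (graph (support t)) iso proper))

-- The exceptional graph

K44-left K44-right : Fin 4 → Fin 8
K44-left  i = i ↑ˡ 4
K44-right i = 4 ↑ʳ i

module K44Weights (w : Fin 8 → Fin 8 → ℕ) (w-sym : ∀ i j → w i j ≡ w j i)
                  (w-zero : ∀ i j → adj K44 i j ≡ false → w i j ≡ 0) where

  left-zero : ∀ i j → w (K44-left i) (K44-left j) ≡ 0
  left-zero i j = w-zero _ _ (toWitness
    {a? = Fin.all? λ i → Fin.all? λ j → adj K44 (K44-left i) (K44-left j) Bool.≟ false} tt i j)

  right-zero : ∀ i j → w (K44-right i) (K44-right j) ≡ 0
  right-zero i j = w-zero _ _ (toWitness
    {a? = Fin.all? λ i → Fin.all? λ j → adj K44 (K44-right i) (K44-right j) Bool.≟ false} tt i j)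

  left-sum : ∀ i → Σv (w (K44-left i)) ≡ Σv (λ j → w (K44-left i) (K44-right j))
  -- The sum over `Fin 8` unfolds to eight terms: the first four stay within the side and vanish,
  -- and the other four are by computation the sum over the right side.
  left-sum i = cong₂ _+_ (left-zero i (# 0)) (cong₂ _+_ (left-zero i (# 1))
    (cong₂ _+_ (left-zero i (# 2)) (cong (_+ Σv (λ j → w (K44-left i) (K44-right j))) (left-zero i (# 3)))))

  right-sum : ∀ j → Σv (w (K44-right j)) ≡ Σv (λ i → w (K44-right j) (K44-left i))
  right-sum j = cong (λ r → w x (# 0) + (w x (# 1) + (w x (# 2) + (w x (# 3) + r)))) (Σv-cong (right-zero j))
    where x = K44-right j

  sides-balance : Σv (λ i → Σv (w (K44-left i))) ≡ Σv (λ j → Σv (w (K44-right j)))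
  sides-balance = begin
    Σv (λ i → Σv (w (K44-left i)))
      ≡⟨ Σv-cong left-sum ⟩
    Σv (λ i → Σv (λ j → w (K44-left i) (K44-right j)))
      ≡⟨ Σv-comm (λ i j → w (K44-left i) (K44-right j)) ⟩
    Σv (λ j → Σv (λ i → w (K44-left i) (K44-right j)))
      ≡⟨ Σv-cong (λ j → Σv-cong (λ i → w-sym (K44-left i) (K44-right j))) ⟩
    Σv (λ j → Σv (λ i → w (K44-right j) (K44-left i)))
      ≡⟨ Σv-cong right-sum ⟨
    Σv (λ j → Σv (w (K44-right j)))
      ∎
    where open ≡-Reasoning

K44-adjacent : ∀ i j → T (adj K44 (K44-left i) (K44-right j))
K44-adjacent = toWitness {a? = Fin.all? λ i → Fin.all? λ j → Bool.T? (adj K44 (K44-left i) (K44-right j))} tt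

-- Excluding `z` leaves at most one color. In the application `z` is the color of a vertex on the
-- opposite side of `K44`, adjacent to both others.
two-colors : ∀ {d} → d ≤ 2 → {x y z : Fin d} → x ≢ z → y ≢ z → x ≡ y
two-colors {1} _ {zero} {zero} _ _ = refl
two-colors {2} _ {zero}     {zero}     _   _   = refl
two-colors {2} _ {suc zero} {suc zero} _   _   = refl
two-colors {2} _ {zero}     {suc zero} {zero}     x≢z _ = contradiction refl x≢z
two-colors {2} _ {zero}     {suc zero} {suc zero} _ y≢z = contradiction refl y≢z
two-colors {2} _ {suc zero} {zero}     {zero}     _ y≢z = contradiction refl y≢z
two-colors {2} _ {suc zero} {zero}     {suc zero} x≢z _ = contradiction refl x≢z
two-colors {suc (suc (suc d))} (s≤s (s≤s ()))

K44-three-values : ∀ {n} (G : SimpleGraph n) → Isomorphic G K44 → (f : EdgeLabeling G) →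
                   IsLocalAntimagic {G = G} f → 3 ≤ distinctValues (vertexSum {G = G} f)
K44-three-values G iso@(σ , e) f la with 3 ≤? distinctValues (vertexSum {G = G} f)
... | yes 3≤d = 3≤d
... | no  3≰d = contradiction sides-equal sides-differ
  where
  s : Fin 8 → ℕ
  s x = vertexSum {G = G} f (from σ x)

  w : Fin 8 → Fin 8 → ℕ
  w x y = edgeLabel {G = G} f (from σ x) (from σ y)

  e⁻¹ : ∀ x y → adj G (from σ x) (from σ y) ≡ adj K44 x y
  e⁻¹ = proj₂ (Isomorphic-sym G K44 iso)

  s≡Σw : ∀ x → s x ≡ Σv (w x)
  s≡Σw x = Σv-permute (edgeLabel {G = G} f (from σ x)) (↔-sym σ)

  d≤2 : distinctValues (vertexSum {G = G} f) ≤ 2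
  d≤2 = ℕ.≤-pred (ℕ.≰⇒> 3≰d)

  proper : ProperColoring K44 _ (valueColoring (vertexSum {G = G} f) ∘ from σ)
  proper = ProperColoring-transport G K44 iso (localAntimagic⇒proper G f la)

  left-constant : ∀ i → s (K44-left i) ≡ s (K44-left zero)
  left-constant i = valueColoring-reflects (vertexSum {G = G} f) (two-colors d≤2
    (proper (K44-left i) (K44-right zero) (K44-adjacent i zero))
    (proper (K44-left zero) (K44-right zero) (K44-adjacent zero zero)))

  right-constant : ∀ j → s (K44-right j) ≡ s (K44-right zero)
  right-constant j = valueColoring-reflects (vertexSum {G = G} f) (two-colors d≤2
    (proper (K44-left zero) (K44-right j) (K44-adjacent zero j) ∘ sym)
    (proper (K44-left zero) (K44-right zero) (K44-adjacent zero zero) ∘ sym))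

  sides-differ : s (K44-left zero) ≢ s (K44-right zero)
  sides-differ = la _ _ (subst T (sym (e⁻¹ (K44-left zero) (K44-right zero))) (K44-adjacent zero zero))

  open K44Weights w (λ x y → edgeLabel-sym G f (from σ x) (from σ y))
                    (λ x y na → edgeLabel-nonadjacent G f (trans (e⁻¹ x y) na))

  sides-equal : s (K44-left zero) ≡ s (K44-right zero)
  -- Each side has four vertices of equal sum and both sides have the same total, so the factor 4
  -- cancels.
  sides-equal = ℕ.*-cancelˡ-≡ (s (K44-left zero)) (s (K44-right zero)) 4 (begin
    4 * s (K44-left zero)                       ≡⟨ Σv-const 4 (s (K44-left zero)) ⟨
    Σv {4} (λ _ → s (K44-left zero))            ≡⟨ Σv-cong (λ i → trans (sym (s≡Σw (K44-left i))) (left-constant i)) ⟨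
    Σv (λ i → Σv (w (K44-left i)))              ≡⟨ sides-balance ⟩
    Σv (λ j → Σv (w (K44-right j)))             ≡⟨ Σv-cong (λ j → trans (sym (s≡Σw (K44-right j))) (right-constant j)) ⟩
    Σv {4} (λ _ → s (K44-right zero))           ≡⟨ Σv-const 4 (s (K44-right zero)) ⟩
    4 * s (K44-right zero)                      ∎)
    where open ≡-Reasoning

K44-2-coloring : Fin 8 → Fin 2
K44-2-coloring x = if toℕ x <ᵇ 4 then zero else suc zero

K44-2-coloring-proper : ProperColoring K44 2 K44-2-coloring
K44-2-coloring-proper = toWitness {a? = Fin.all? λ u → Fin.all? λ v →
  Bool.T? (adj K44 u v) →-dec ¬? (K44-2-coloring u Fin.≟ K44-2-coloring v)} tt

-- Turns `suc k` in the exceptional case into the number 3 supplied by the table and by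
-- `K44-three-values`.
chromatic-K44 : ∀ {n k} (G : SimpleGraph n) → Isomorphic G K44 → IsChromaticNumber G k → k ≡ 2
chromatic-K44 {k = k} G iso (c , proper , minimal) = ℕ.≤-antisym
  (minimal 2 _ (ProperColoring-transport K44 G (Isomorphic-sym G K44 iso) K44-2-coloring-proper))
  (twoDistinct _ _ (ProperColoring-transport G K44 iso proper zero (K44-right zero) (K44-adjacent zero zero)))
  where
  twoDistinct : ∀ {k} (x y : Fin k) → x ≢ y → 2 ≤ k
  twoDistinct {1} zero zero x≢y = contradiction refl x≢y
  twoDistinct {suc (suc k)} _ _ _ = s≤s (s≤s z≤n)

-- Entry (i , j) is the label of the edge ij, or 0 if i and j are not adjacent.  The graphs of order 7
-- and 8 other than K44 are named after their 2-regular or cubic complement.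

K5-table : Tri ℕ 5
K5-table =
  (5 ∷ 8 ∷ 3 ∷ 9 ∷ []) ▷
  (6 ∷ 4 ∷ 1 ∷ []) ▷
  (7 ∷ 2 ∷ []) ▷
  (10 ∷ []) ▷
  [] ▷ △

K222-table : Tri ℕ 6
K222-table =
  (0 ∷ 11 ∷ 2 ∷ 8 ∷ 5 ∷ []) ▷
  (3 ∷ 6 ∷ 7 ∷ 10 ∷ []) ▷
  (0 ∷ 1 ∷ 9 ∷ []) ▷
  (12 ∷ 4 ∷ []) ▷
  (0 ∷ []) ▷
  [] ▷ △

co-C3+C4-table : Tri ℕ 7
co-C3+C4-table =
  (0 ∷ 0 ∷ 3 ∷ 14 ∷ 9 ∷ 8 ∷ []) ▷
  (0 ∷ 5 ∷ 10 ∷ 7 ∷ 12 ∷ []) ▷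
  (13 ∷ 6 ∷ 4 ∷ 11 ∷ []) ▷
  (0 ∷ 0 ∷ 1 ∷ []) ▷
  (2 ∷ 0 ∷ []) ▷
  (0 ∷ []) ▷
  [] ▷ △

co-C7-table : Tri ℕ 7
co-C7-table =
  (0 ∷ 0 ∷ 1 ∷ 9 ∷ 14 ∷ 5 ∷ []) ▷
  (10 ∷ 0 ∷ 13 ∷ 6 ∷ 3 ∷ []) ▷
  (8 ∷ 0 ∷ 4 ∷ 7 ∷ []) ▷
  (12 ∷ 0 ∷ 11 ∷ []) ▷
  (2 ∷ 0 ∷ []) ▷
  (0 ∷ []) ▷
  [] ▷ △

-- The sums on the left side are 36, 32, 36, 32 and those on the right side are all 34, hence three
-- values.
K44-table : Tri ℕ 8
K44-table =
  (0 ∷ 0 ∷ 0 ∷ 10 ∷ 15 ∷ 9 ∷ 2 ∷ []) ▷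
  (0 ∷ 0 ∷ 1 ∷ 12 ∷ 6 ∷ 13 ∷ []) ▷
  (0 ∷ 16 ∷ 4 ∷ 11 ∷ 5 ∷ []) ▷
  (7 ∷ 3 ∷ 8 ∷ 14 ∷ []) ▷
  (0 ∷ 0 ∷ 0 ∷ []) ▷
  (0 ∷ 0 ∷ []) ▷
  (0 ∷ []) ▷
  [] ▷ △

co-2diamonds-table : Tri ℕ 8
co-2diamonds-table =
  (0 ∷ 0 ∷ 0 ∷ 5 ∷ 16 ∷ 11 ∷ 4 ∷ []) ▷
  (0 ∷ 0 ∷ 2 ∷ 7 ∷ 12 ∷ 15 ∷ []) ▷
  (13 ∷ 0 ∷ 1 ∷ 8 ∷ 9 ∷ []) ▷
  (14 ∷ 0 ∷ 3 ∷ 6 ∷ []) ▷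
  (10 ∷ 0 ∷ 0 ∷ []) ▷
  (0 ∷ 0 ∷ []) ▷
  (0 ∷ []) ▷
  [] ▷ △

co-2triangles-table : Tri ℕ 8
co-2triangles-table =
  (0 ∷ 0 ∷ 0 ∷ 10 ∷ 2 ∷ 16 ∷ 6 ∷ []) ▷
  (0 ∷ 11 ∷ 0 ∷ 14 ∷ 8 ∷ 1 ∷ []) ▷
  (4 ∷ 15 ∷ 0 ∷ 3 ∷ 12 ∷ []) ▷
  (0 ∷ 9 ∷ 0 ∷ 13 ∷ []) ▷
  (7 ∷ 5 ∷ 0 ∷ []) ▷
  (0 ∷ 0 ∷ []) ▷
  (0 ∷ []) ▷
  [] ▷ △

co-1triangle-table : Tri ℕ 8
co-1triangle-table =
  (0 ∷ 0 ∷ 0 ∷ 10 ∷ 9 ∷ 6 ∷ 7 ∷ []) ▷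
  (0 ∷ 2 ∷ 0 ∷ 14 ∷ 12 ∷ 4 ∷ []) ▷
  (5 ∷ 3 ∷ 0 ∷ 13 ∷ 11 ∷ []) ▷
  (16 ∷ 15 ∷ 0 ∷ 0 ∷ []) ▷
  (1 ∷ 0 ∷ 0 ∷ []) ▷
  (0 ∷ 0 ∷ []) ▷
  (8 ∷ []) ▷
  [] ▷ △

co-cube-table : Tri ℕ 8
co-cube-table =
  (0 ∷ 0 ∷ 0 ∷ 5 ∷ 15 ∷ 11 ∷ 16 ∷ []) ▷
  (6 ∷ 8 ∷ 0 ∷ 0 ∷ 7 ∷ 2 ∷ []) ▷
  (12 ∷ 0 ∷ 10 ∷ 0 ∷ 3 ∷ []) ▷
  (13 ∷ 0 ∷ 0 ∷ 14 ∷ []) ▷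
  (1 ∷ 4 ∷ 0 ∷ []) ▷
  (9 ∷ 0 ∷ []) ▷
  (0 ∷ []) ▷
  [] ▷ △

co-wagner-table : Tri ℕ 8
co-wagner-table =
  (0 ∷ 0 ∷ 0 ∷ 3 ∷ 5 ∷ 12 ∷ 15 ∷ []) ▷
  (7 ∷ 13 ∷ 0 ∷ 0 ∷ 4 ∷ 2 ∷ []) ▷
  (11 ∷ 0 ∷ 16 ∷ 0 ∷ 1 ∷ []) ▷
  (9 ∷ 0 ∷ 10 ∷ 0 ∷ []) ▷
  (8 ∷ 6 ∷ 0 ∷ []) ▷
  (0 ∷ 14 ∷ []) ▷
  (0 ∷ []) ▷
  [] ▷ △

-- The exceptional value and the classification by tables

K44-table-valid : IsLocalAntimagicTable K44-table
K44-table-valid = toWitness {a? = isLocalAntimagicTable? K44-table} tt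

K44≅K44-table : Isomorphic K44 (graph (support K44-table))
K44≅K44-table = ≗⇒Isomorphic K44 (graph (support K44-table)) (toWitness
  {a? = Fin.all? λ i → Fin.all? λ j → adj (graph (support K44-table)) i j Bool.≟ adj K44 i j} tt)

χ-la-K44 : ∀ {n k} (G : SimpleGraph n) → Regular G 4 → Isomorphic G K44 → IsChromaticNumber G k →
           IsLocalAntimagicChromaticNumber G (suc k)
-- The isomorphism forces the order 8, and with `k` equal to 2 all numbers involved become literals.
χ-la-K44 {k = k} G reg iso χ with Perm.↔⇒≡ (proj₁ iso) | chromatic-K44 G iso χ
... | refl | refl =
  let f , la , ≤3 = table⇒labeling G reg K44-table K44-table-valid
                      (Isomorphic-trans G K44 (graph (support K44-table)) iso K44≅K44-table) in
  f , (la , ℕ.≤-antisym ≤3 (K44-three-values G iso f la)) , K44-three-values G iso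

OptimallyTabulated : ∀ {n} → SimpleGraph n → Set
OptimallyTabulated {n} G = Σ[ t ∈ Tri ℕ n ] (IsOptimalTable t × Isomorphic G (graph (support t)))

tabulated : ∀ {n} (G : SimpleGraph n) {ts : List (Tri ℕ n)} → All IsOptimalTable ts →
            Any (λ t → Isomorphic G (graph (support t))) ts → OptimallyTabulated G
tabulated G optimal found = Any.lookup found , All.lookupAny optimal found

-- A Boolean equation, so that `refl` proves it by running the enumeration and the isomorphism
-- search during type checking.
Complete : ∀ {n} → List (Tri ℕ (suc n)) → Set
Complete {n} ts = forallQuartic n (λ s → is-just (findAmong s (map support ts))) ≡ true

classifyByTables : ∀ {n} (ts : List (Tri ℕ (suc n))) → Complete ts → (G : SimpleGraph (suc n)) → Regular G 4 →
                   Any (λ t → Isomorphic G (graph (support t))) ts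
classifyByTables ts complete G reg = Any.map⁻ (classify (map support ts) complete G reg)

tables₅ : List (Tri ℕ 5)
tables₅ = K5-table ∷ []

tables₅-optimal : All IsOptimalTable tables₅
tables₅-optimal = toWitness {a? = All.all? isOptimalTable? tables₅} tt

tables₅-complete : Complete tables₅
tables₅-complete = refl

tables₆ : List (Tri ℕ 6)
tables₆ = K222-table ∷ []

tables₆-optimal : All IsOptimalTable tables₆
tables₆-optimal = toWitness {a? = All.all? isOptimalTable? tables₆} tt

tables₆-complete : Complete tables₆
tables₆-complete = refl

tables₇ : List (Tri ℕ 7)
tables₇ = co-C3+C4-table ∷ co-C7-table ∷ []

tables₇-optimal : All IsOptimalTable tables₇
tables₇-optimal = toWitness {a? = All.all? isOptimalTable? tables₇} tt

tables₇-complete : Complete tables₇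
tables₇-complete = refl

-- By decreasing number of labeled graphs, which shortens the search.
tables₈ : List (Tri ℕ 8)
tables₈ = co-2triangles-table ∷ co-1triangle-table ∷ co-2diamonds-table ∷ co-wagner-table ∷ co-cube-table ∷ []

tables₈-optimal : All IsOptimalTable tables₈
tables₈-optimal = toWitness {a? = All.all? isOptimalTable? tables₈} tt

tables₈-complete : Complete (tables₈ ++ K44-table ∷ [])
tables₈-complete = refl

classify₈ : (G : SimpleGraph 8) → Regular G 4 → Isomorphic G K44 ⊎ OptimallyTabulated G
classify₈ G reg = split (Any.++⁻ tables₈ (classifyByTables (tables₈ ++ K44-table ∷ []) tables₈-complete G reg))
  where
  split : Any (λ t → Isomorphic G (graph (support t))) tables₈ ⊎
          Any (λ t → Isomorphic G (graph (support t))) (K44-table ∷ []) →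
          Isomorphic G K44 ⊎ OptimallyTabulated G
  split (inj₁ found)      = inj₂ (tabulated G tables₈-optimal found)
  split (inj₂ (here iso)) = inj₁ (Isomorphic-trans G (graph (support K44-table)) K44 iso
                                   (Isomorphic-sym K44 (graph (support K44-table)) K44≅K44-table))

classifyQuartic : ∀ {p} → 5 ≤ p → p ≤ 8 → (G : SimpleGraph p) → Regular G 4 →
                  Isomorphic G K44 ⊎ OptimallyTabulated G
classifyQuartic {5} _ _ G reg = inj₂ (tabulated G tables₅-optimal (classifyByTables tables₅ tables₅-complete G reg))
classifyQuartic {6} _ _ G reg = inj₂ (tabulated G tables₆-optimal (classifyByTables tables₆ tables₆-complete G reg))
classifyQuartic {7} _ _ G reg = inj₂ (tabulated G tables₇-optimal (classifyByTables tables₇ tables₇-complete G reg))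
classifyQuartic {8} _ _ G reg = classify₈ G reg
classifyQuartic {1} (s≤s ()) _
classifyQuartic {2} (s≤s (s≤s ())) _
classifyQuartic {3} (s≤s (s≤s (s≤s ()))) _
classifyQuartic {4} (s≤s (s≤s (s≤s (s≤s ())))) _
classifyQuartic {suc (suc (suc (suc (suc (suc (suc (suc (suc p))))))))} _
  (s≤s (s≤s (s≤s (s≤s (s≤s (s≤s (s≤s (s≤s ()))))))))

theorem2p5 : (p : ℕ) → 5 ≤ p → p ≤ 8 → (G : SimpleGraph p) → Regular G 4 →
    (k : ℕ) → IsChromaticNumber G k →
    (Isomorphic G K44 → IsLocalAntimagicChromaticNumber G (suc k))
    × (¬ Isomorphic G K44 → IsLocalAntimagicChromaticNumber G k)
theorem2p5 p 5≤p p≤8 G reg k χ = (λ iso → χ-la-K44 G reg iso χ) , generic (classifyQuartic 5≤p p≤8 G reg)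
  where
  generic : Isomorphic G K44 ⊎ OptimallyTabulated G → ¬ Isomorphic G K44 → IsLocalAntimagicChromaticNumber G k
  generic (inj₁ iso)             ¬iso = contradiction iso ¬iso
  generic (inj₂ (t , opt , iso)) _    = optimal⇒χ-la G reg χ t opt iso
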